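{- Suppose $\mathfrak{F} = (F; +, \cdot, \le)$ is an ordered field. If $\mathfrak{F}$ is convexly orderable, then every positive element of $F$ has an $n^{\text{th}}$ root in $F$ for all $n \ge 1$.
   Context: A structure $\mathfrak{M}$ is convexly orderable if there is a linear order $\unlhd$ on $M$ (not necessarily definable) such that for every formula $\varphi(x;\bar y)$ ($x$ a single variable) there is $k<\omega$ such that for all $\bar b\in M^{|\bar y|}$, the set $\varphi(\mathfrak{M};\bar b)=\{a\in M:\mathfrak{M}\models\varphi(a;\bar b)\}$ is a union of at most $k$ $\unlhd$-convex subsets of $M$. Here $\unlhd$ need not be the field order $\le$. -}

module Defs where

open import Algebra.Bundles using (CommutativeRing)
open import Data.Empty.Polymorphic using (⊥)
open import Data.Fin.Base using (Fin; zero; suc)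
open import Data.Nat.Base as ℕ using (ℕ; suc)
open import Data.Product.Base using (Σ; ∃; _×_)
open import Data.Sum.Base using (_⊎_)
open import Data.Vec.Functional using (Vector; _∷_)
open import Data.Vec.Functional.Relation.Binary.Pointwise using (Pointwise)
open import Level using (Level; Lift; _⊔_) renaming (suc to lsuc)
open import Relation.Binary.Core using (Rel)
open import Relation.Binary.Structures using (IsEquivalence; IsTotalOrder)
open import Relation.Nullary.Negation.Core using (¬_)
open import Relation.Unary using (Pred; _≐_; ⋃)
import Relation.Binary.Construct.NonStrictToStrict as ToStrict

private
  variable
    c ℓ p r : Level

record Signature : Set₁ where
  field
    Func : ℕ → Set
    Reln : ℕ → Set

open Signature

data Term (L : Signature) (n : ℕ) : Set where
  var : Fin n → Term L n
  app : ∀ {k} → Func L k → Vector (Term L n) k → Term L n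

-- Formulas whose free variables are among n de Bruijn variables; a quantifier
-- binds variable zero of its body.
data Formula (L : Signature) (n : ℕ) : Set where
  _≐ᶠ_       : Term L n → Term L n → Formula L n
  rel        : ∀ {k} → Reln L k → Vector (Term L n) k → Formula L n
  ⊥ᶠ         : Formula L n
  _∧ᶠ_ _∨ᶠ_  : Formula L n → Formula L n → Formula L n
  _⇒ᶠ_       : Formula L n → Formula L n → Formula L n
  ∀ᶠ_ ∃ᶠ_    : Formula L (suc n) → Formula L n

-- The universe is a setoid, and equality of terms is interpreted by _≈_.
record Structure (L : Signature) (c ℓ : Level) : Set (lsuc (c ⊔ ℓ)) where
  infix 4 _≈_
  field
    Carrier       : Set c
    _≈_           : Rel Carrier ℓ
    isEquivalence : IsEquivalence _≈_
    ⟦_⟧ᶠ          : ∀ {k} → Func L k → Vector Carrier k → Carrier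
    ⟦_⟧ʳ          : ∀ {k} → Reln L k → Vector Carrier k → Set ℓ
    func-cong     : ∀ {k} (f : Func L k) {xs ys : Vector Carrier k} →
                    Pointwise _≈_ xs ys → ⟦ f ⟧ᶠ xs ≈ ⟦ f ⟧ᶠ ys
    reln-resp     : ∀ {k} (R : Reln L k) {xs ys : Vector Carrier k} →
                    Pointwise _≈_ xs ys → ⟦ R ⟧ʳ xs → ⟦ R ⟧ʳ ys

module Semantics {L : Signature} (𝔐 : Structure L c ℓ) where
  open Structure 𝔐

  eval : ∀ {n} → Vector Carrier n → Term L n → Carrier
  eval ρ (var i)    = ρ i
  eval ρ (app f ts) = ⟦ f ⟧ᶠ (λ i → eval ρ (ts i))

  infix 4 _⊨_
  _⊨_ : ∀ {n} → Vector Carrier n → Formula L n → Set (c ⊔ ℓ)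
  ρ ⊨ (s ≐ᶠ t)   = Lift c (eval ρ s ≈ eval ρ t)
  ρ ⊨ (rel R ts) = Lift c (⟦ R ⟧ʳ (λ i → eval ρ (ts i)))
  ρ ⊨ ⊥ᶠ         = ⊥
  ρ ⊨ (φ ∧ᶠ ψ)   = (ρ ⊨ φ) × (ρ ⊨ ψ)
  ρ ⊨ (φ ∨ᶠ ψ)   = (ρ ⊨ φ) ⊎ (ρ ⊨ ψ)
  ρ ⊨ (φ ⇒ᶠ ψ)   = ρ ⊨ φ → ρ ⊨ ψ
  ρ ⊨ (∀ᶠ φ)     = ∀ a → (a ∷ ρ) ⊨ φ
  ρ ⊨ (∃ᶠ φ)     = ∃ λ a → (a ∷ ρ) ⊨ φ

  -- φ(𝔐; b̄), where variable zero of φ plays the role of x and the remaining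
  -- variables that of ȳ.
  definableSet : ∀ {n} → Formula L (suc n) → Vector Carrier n → Pred Carrier (c ⊔ ℓ)
  definableSet φ b a = (a ∷ b) ⊨ φ

-- When _⊴_ is reflexive over a setoid equality, a convex predicate
-- automatically respects that equality.
Convex : {A : Set c} → Rel A r → Pred A p → Set (c ⊔ r ⊔ p)
Convex _⊴_ C = ∀ {x y z} → C x → C z → x ⊴ y → y ⊴ z → C y

UnionOfAtMost : {A : Set c} → ℕ → Rel A r → Pred A p → Set (c ⊔ r ⊔ lsuc p)
UnionOfAtMost {p = p} {A = A} k _⊴_ X =
  Σ ℕ λ m → m ℕ.≤ k × Σ (Fin m → Pred A p) λ C →
    (∀ i → Convex _⊴_ (C i)) × X ≐ ⋃ (Fin m) C

record ConvexlyOrderable {L : Signature} (𝔐 : Structure L c ℓ) : Set (lsuc (c ⊔ ℓ)) where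
  open Structure 𝔐
  open Semantics 𝔐
  field
    _⊴_          : Rel Carrier (c ⊔ ℓ)
    isTotalOrder : IsTotalOrder _≈_ _⊴_
    bounded      : ∀ {n} (φ : Formula L (suc n)) → ∃ λ k →
                   ∀ (b : Vector Carrier n) → UnionOfAtMost k _⊴_ (definableSet φ b)

record OrderedField (c ℓ : Level) : Set (lsuc (c ⊔ ℓ)) where
  field
    commutativeRing : CommutativeRing c ℓ

  open CommutativeRing commutativeRing public

  infix 4 _≤_
  field
    0≉1          : ¬ 0# ≈ 1#
    inverse      : ∀ x → ¬ x ≈ 0# → ∃ λ y → x * y ≈ 1#
    _≤_          : Rel Carrier ℓ
    isTotalOrder : IsTotalOrder _≈_ _≤_
    +-monoˡ-≤    : ∀ {x y} z → x ≤ y → x + z ≤ y + z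
    *-nonNeg     : ∀ {x y} → 0# ≤ x → 0# ≤ y → 0# ≤ x * y

  open ToStrict _≈_ _≤_ public using (_<_)

  open import Algebra.Properties.Semiring.Exp semiring public using (_^_)

data FieldFunc : ℕ → Set where
  plus times : FieldFunc 2

data FieldReln : ℕ → Set where
  leq : FieldReln 2

orderedFieldSignature : Signature
orderedFieldSignature = record { Func = FieldFunc ; Reln = FieldReln }

-- The structure (F; +, ·, ≤).
structure : OrderedField c ℓ → Structure orderedFieldSignature c ℓ
structure {c} {ℓ} 𝔽 = record
  { Carrier       = Carrier
  ; _≈_           = _≈_
  ; isEquivalence = isEquivalence
  ; ⟦_⟧ᶠ          = func
  ; ⟦_⟧ʳ          = reln
  ; func-cong     = cong
  ; reln-resp     = resp
  }
  where
  open OrderedField 𝔽 hiding (zero)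
  open IsTotalOrder isTotalOrder using (≤-respˡ-≈; ≤-respʳ-≈)

  func : ∀ {k} → FieldFunc k → Vector Carrier k → Carrier
  func plus  xs = xs zero + xs (suc zero)
  func times xs = xs zero * xs (suc zero)

  reln : ∀ {k} → FieldReln k → Vector Carrier k → Set ℓ
  reln leq xs = xs zero ≤ xs (suc zero)

  cong : ∀ {k} (f : FieldFunc k) {xs ys : Vector Carrier k} →
         Pointwise _≈_ xs ys → func f xs ≈ func f ys
  cong plus  eq = +-cong (eq zero) (eq (suc zero))
  cong times eq = *-cong (eq zero) (eq (suc zero))

  resp : ∀ {k} (R : FieldReln k) {xs ys : Vector Carrier k} →
         Pointwise _≈_ xs ys → reln R xs → reln R ys
  resp leq eq le = ≤-respʳ-≈ (eq (suc zero)) (≤-respˡ-≈ (eq zero) le)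

{-# OPTIONS --safe #-}

-- If x has no n-th root, then modulo the N-th powers, N = n ^ m, the elements
-- x ^ (n ^ i) with i < m lie in different classes, so the definable sets
-- { z ^ N * x ^ (n ^ i) : 1 ≤ z } are pairwise disjoint, and they are unbounded
-- for ≤.  Each of them is a finite union of ⊴-convex sets, hence contains an
-- unbounded ⊴-convex set P i.  Pick a point in each P i, and b above all of
-- them.  The ray { w : w ≤ b } is a union of k ⊴-convex sets, where k does not
-- depend on b or m.  For m > 2k one of these contains three of the chosen
-- points, hence all of the P i of the ⊴-middle one, which is thereby bounded.
module Submission where

open import Defs
open import Algebra.Bundles using (CommutativeRing)
open import Axiom.DoubleNegationElimination using (em⇒dne)
open import Axiom.ExcludedMiddle using (ExcludedMiddle)
open import Data.Fin.Base using (Fin; zero; suc; combine; toℕ)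
open import Data.Fin.Properties using (pigeonhole; combine-injective; toℕ<n)
import Data.Fin.Properties as Finₚ
import Data.List.Base as List
open import Data.List.Relation.Unary.All using (head)
open import Data.List.Relation.Unary.All.Properties using (tabulate⁻)
open import Data.Nat.Base as ℕ using (ℕ; zero; suc)
import Data.Nat.Properties as ℕₚ
open import Data.Product.Base using (∃; ∃₂; ∃-syntax; _×_; _,_; proj₁; proj₂)
open import Data.Sum.Base using (_⊎_; inj₁; inj₂; [_,_]′)
open import Data.Vec.Functional using (_∷_; [])
open import Level using (Level; Lift; lift; lower; _⊔_)
open import Relation.Binary.Bundles using (TotalOrder)
open import Relation.Binary.Core using (Rel)
open import Relation.Binary.Definitions using (Total; tri<; tri≈; tri>)
open import Relation.Binary.PropositionalEquality as ≡ using (_≡_; _≢_)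
open import Relation.Binary.Structures using (IsTotalOrder)
open import Relation.Nullary using (¬_; Dec; yes; no; contradiction)
open import Relation.Unary using (Pred; _⊆_; _≐_; ⋃)

private
  variable
    c ℓ p r : Level

-- Disjoint families, unbounded sets and unions of convex pieces.

Disjoint : {I : Set} {A : Set c} → (I → Pred A p) → Set (c ⊔ p)
Disjoint X = ∀ {i j w} → i ≢ j → X i w → ¬ X j w

Unbounded : {A : Set c} → Rel A ℓ → Pred A p → Set (c ⊔ ℓ ⊔ p)
Unbounded _≤_ X = ∀ b → ∃[ w ] X w × ¬ w ≤ b

UnionOfAtMost-resp-≐ : ∀ {A : Set c} {k} {_⊴_ : Rel A r} {X Y : Pred A p} →
  X ≐ Y → UnionOfAtMost k _⊴_ X → UnionOfAtMost k _⊴_ Y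
UnionOfAtMost-resp-≐ (X⊆Y , Y⊆X) (m , m≤k , C , C-convex , X⊆⋃C , ⋃C⊆X) =
  m , m≤k , C , C-convex , (λ w∈Y → X⊆⋃C (Y⊆X w∈Y)) , (λ w∈⋃C → X⊆Y (⋃C⊆X w∈⋃C))

-- Pigeonhole for disjoint convex sets meeting few convex blocks.

module Covering (em : ExcludedMiddle r) {A : Set c} {_⊴_ : Rel A r}
                (⊴-total : Total _⊴_) where

  -- A point is flagged when some other point of its block lies ⊴-below it;
  -- two points with equal block and flag put three points in one block.
  convex-absorbed : ∀ {k m} → m ℕ.≤ k →
    {C : Fin m → Pred A p} → (∀ j → Convex _⊴_ (C j)) →
    {P : Fin (suc (k ℕ.* 2)) → Pred A p} → (∀ i → Convex _⊴_ (P i)) → Disjoint P →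
    (a : ∀ i → ∃ (P i)) → (∀ i → ⋃ (Fin m) C (proj₁ (a i))) →
    ∃₂ λ i j → P i ⊆ C j
  convex-absorbed {k = k} {m} m≤k {C} C-convex {P} P-convex P-disjoint a a∈⋃C =
    conclusion (⊴-total (pt u) (pt v))
    where
    pt : Fin (suc (k ℕ.* 2)) → A
    pt i = proj₁ (a i)

    block : Fin (suc (k ℕ.* 2)) → Fin m
    block i = proj₁ (a∈⋃C i)

    Preceded : Fin (suc (k ℕ.* 2)) → Set r
    Preceded i = ∃[ h ] h ≢ i × block h ≡ block i × pt h ⊴ pt i

    indicator : ∀ {i} → Dec (Preceded i) → Fin 2
    indicator (yes _) = suc zero
    indicator (no _)  = zero

    flag : Fin (suc (k ℕ.* 2)) → Fin 2
    flag i = indicator (em {Preceded i})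

    flag-transfer : ∀ {i j} → flag i ≡ flag j → Preceded j → Preceded i
    flag-transfer {i} {j} eq pj with em {Preceded i} | em {Preceded j}
    ... | yes pi | _     = pi
    ... | no _   | no ¬p = contradiction pj ¬p
    flag-transfer () pj | no _ | yes _

    -- If `w` were ⊴-below `pt h`, convexity would put `pt h` into `P i`; if it were above `pt j`,
    -- convexity would put `pt j` there. Disjointness forbids both, so `w` is caught between two
    -- points of one block.
    absorbed : ∀ {i j} → i ≢ j → block i ≡ block j → flag i ≡ flag j →
               pt i ⊴ pt j → P i ⊆ C (block i)
    absorbed {i} {j} i≢j bi≡bj fi≡fj i⊴j {w} w∈Pi
      with h , h≢i , bh≡bi , h⊴i ← flag-transfer fi≡fj (i , i≢j , bi≡bj , i⊴j)
      = C-convex (block i)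
          (≡.subst (λ t → C t (pt h)) bh≡bi (proj₂ (a∈⋃C h)))
          (≡.subst (λ t → C t (pt j)) (≡.sym bi≡bj) (proj₂ (a∈⋃C j)))
          h⊴w w⊴j
      where
      h⊴w : pt h ⊴ w
      h⊴w with ⊴-total (pt h) w
      ... | inj₁ h⊴w = h⊴w
      ... | inj₂ w⊴h = contradiction (P-convex i w∈Pi (proj₂ (a i)) w⊴h h⊴i)
                                     (P-disjoint h≢i (proj₂ (a h)))
      w⊴j : w ⊴ pt j
      w⊴j with ⊴-total w (pt j)
      ... | inj₁ w⊴j = w⊴j
      ... | inj₂ j⊴w = contradiction (proj₂ (a j))
                         (P-disjoint i≢j (P-convex i (proj₂ (a i)) w∈Pi i⊴j j⊴w))

    -- Block and flag take at most `k * 2` joint values; this dictates the number `suc (k * 2)` of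
    -- points.
    collision = pigeonhole (ℕ.s≤s (ℕₚ.*-monoˡ-≤ 2 m≤k)) (λ i → combine (block i) (flag i))
    u = proj₁ collision
    v = proj₁ (proj₂ collision)
    u≢v : u ≢ v
    u≢v = Finₚ.<⇒≢ (proj₁ (proj₂ (proj₂ collision)))
    same = combine-injective (block u) (flag u) (block v) (flag v)
             (proj₂ (proj₂ (proj₂ collision)))
    same-block = proj₁ same
    same-flag  = proj₂ same

    conclusion : pt u ⊴ pt v ⊎ pt v ⊴ pt u → ∃₂ λ i j → P i ⊆ C j
    -- The ⊴-lower of the two colliding points is the middle one of the three.
    conclusion (inj₁ u⊴v) = u , block u , absorbed u≢v same-block same-flag u⊴v
    conclusion (inj₂ v⊴u) = v , block v ,
      absorbed (≡.≢-sym u≢v) (≡.sym same-block) (≡.sym same-flag) v⊴u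

-- Unbounded sets against rays in a total order.

module Unboundedness (em : ExcludedMiddle (c ⊔ ℓ)) (T : TotalOrder c ℓ ℓ) where
  open TotalOrder T
  open import Data.List.Extrema T using (max; xs≤max)

  upperBound : ∀ {n} → Carrier → (f : Fin n → Carrier) → ∃ λ b → ∀ i → f i ≤ b
  -- `a` serves as the maximum of an empty family.
  upperBound a f = max a (List.tabulate f) , tabulate⁻ (xs≤max a (List.tabulate f))

  -- If every `C i` had a bound, the largest of these finitely many bounds would bound `X`.
  unbounded-piece : ∀ {m} {X : Pred Carrier (c ⊔ ℓ)} {C : Fin m → Pred Carrier (c ⊔ ℓ)} →
    Carrier → X ⊆ ⋃ (Fin m) C → Unbounded _≤_ X → ∃[ i ] Unbounded _≤_ (C i)
  unbounded-piece {C = C} a X⊆⋃C X-unbounded = em⇒dne em λ none →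
    let bounds : ∀ i → ∃[ b ] (∀ w → C i w → w ≤ b)
        bounds i = em⇒dne em λ ¬bounded → none (i , λ b → em⇒dne em λ ¬above →
          -- `w ≤ b` lives at level `ℓ`, so it is lifted to the level where excluded middle is
          -- assumed.
          ¬bounded (b , λ w w∈C → lower {ℓ = c} (em⇒dne em λ w≰b →
            ¬above (w , w∈C , λ w≤b → w≰b (lift w≤b)))))
        b , bounds≤b = upperBound a (λ i → proj₁ (bounds i))
        w , w∈X , w≰b = X-unbounded b
        i , w∈Ci = X⊆⋃C w∈X
    in w≰b (trans (proj₂ (bounds i) w w∈Ci) (bounds≤b i))

  -- The combinatorial core, free of field operations. The bound `b` is taken after the points of
  -- the `P i`, which the uniformity of `k` in `b` permits; a block of the ray at `b` then swallows
  -- a whole unbounded `P i`.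
  few-unbounded : ∀ {_⊴_ : Rel Carrier (c ⊔ ℓ)} {k} → Carrier → Total _⊴_ →
    (∀ b → UnionOfAtMost {p = c ⊔ ℓ} k _⊴_ (λ w → Lift c (w ≤ b))) →
    {X : Fin (suc (k ℕ.* 2)) → Pred Carrier (c ⊔ ℓ)} → Disjoint X →
    (∀ i → ∃[ l ] UnionOfAtMost l _⊴_ (X i)) → ¬ (∀ i → Unbounded _≤_ (X i))
  few-unbounded {_⊴_} {k} o ⊴-total rays {X} X-disjoint X-pieces X-unbounded =
    let b , a≤b = upperBound o (λ i → proj₁ (a i))
        _ , m≤k , D , D-convex , ray⊆⋃D , ⋃D⊆ray = rays b
        i , j , Pi⊆Dj = Covering.convex-absorbed em ⊴-total m≤k D-convex P-convex
                          (λ i≢j Pi Pj → X-disjoint i≢j (P⊆X _ Pi) (P⊆X _ Pj))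
                          a (λ i → ray⊆⋃D (lift (a≤b i)))
        w , w∈Pi , w≰b = P-unbounded i b
    in w≰b (lower (⋃D⊆ray (j , Pi⊆Dj w∈Pi)))
    where
    piece : ∀ i → ∃[ P ] Convex _⊴_ P × P ⊆ X i × Unbounded _≤_ P
    piece i =
      let _ , _ , _ , C , C-convex , X⊆⋃C , ⋃C⊆X = X-pieces i
          j , Cj-unbounded = unbounded-piece o X⊆⋃C (X-unbounded i)
      in C j , C-convex j , (λ w∈Cj → ⋃C⊆X (j , w∈Cj)) , Cj-unbounded

    P : Fin (suc (k ℕ.* 2)) → Pred Carrier (c ⊔ ℓ)
    P i = proj₁ (piece i)

    P-convex : ∀ i → Convex _⊴_ (P i)
    P-convex i = proj₁ (proj₂ (piece i))

    P⊆X : ∀ i → P i ⊆ X i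
    P⊆X i = proj₁ (proj₂ (proj₂ (piece i)))

    P-unbounded : ∀ i → Unbounded _≤_ (P i)
    P-unbounded i = proj₂ (proj₂ (proj₂ (piece i)))

    a : ∀ i → ∃ (P i)
    -- Unboundedness at any one bound, here `o`, yields a point.
    a i = let w , w∈P , _ = P-unbounded i o in w , w∈P

-- The gap is given as a successor so that `n ^ suc d` exposes a factor `n`.
<⇒∃-suc : ∀ {i j} → i ℕ.< j → ∃[ d ] i ℕ.+ suc d ≡ j
<⇒∃-suc {i} i<j with d , eq ← ℕₚ.m≤n⇒∃[o]m+o≡n i<j = d , ≡.trans (ℕₚ.+-suc i d) eq

-- Ordered fields: inequalities for products and powers.

module OrderedFieldProperties (𝔽 : OrderedField c ℓ) where
  open OrderedField 𝔽 hiding (zero; isTotalOrder; refl; sym; trans; reflexive)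
  open import Algebra.Properties.CommutativeSemiring.Exp
    (CommutativeRing.commutativeSemiring commutativeRing)
    using (^-distrib-*; ^-assocʳ; ^-congˡ; ^-congʳ)
  open import Algebra.Properties.Group +-group using (//-rightDividesˡ; //-rightDividesʳ; ⁻¹-involutive)
  open import Algebra.Properties.Ring ring using ([y-z]x≈yx-zx; -1*x≈-x)

  ≤-totalOrder : TotalOrder c ℓ ℓ
  ≤-totalOrder = record { isTotalOrder = OrderedField.isTotalOrder 𝔽 }

  open TotalOrder ≤-totalOrder
    using (refl; antisym; total; ≤-respˡ-≈; ≤-respʳ-≈; poset; module Eq)
    renaming (trans to ≤-trans)
  open import Data.List.Extrema ≤-totalOrder using (max; ⊥≤max; xs≤max)
  open import Relation.Binary.Reasoning.PartialOrder poset

  x≤y⇒0≤y-x : ∀ {x y} → x ≤ y → 0# ≤ y - x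
  x≤y⇒0≤y-x {x} {y} x≤y = ≤-respˡ-≈ (-‿inverseʳ x) (+-monoˡ-≤ (- x) x≤y)

  *-monoˡ-≤ : ∀ {x y z} → 0# ≤ z → x ≤ y → x * z ≤ y * z
  *-monoˡ-≤ {x} {y} {z} 0≤z x≤y = begin
    x * z                  ≈⟨ +-identityˡ (x * z) ⟨
    0# + x * z             ≤⟨ +-monoˡ-≤ (x * z) (*-nonNeg (x≤y⇒0≤y-x x≤y) 0≤z) ⟩
    (y - x) * z + x * z    ≈⟨ +-congʳ ([y-z]x≈yx-zx z y x) ⟩
    y * z - x * z + x * z  ≈⟨ //-rightDividesˡ (x * z) (y * z) ⟩
    y * z                  ∎

  *-monoʳ-≤ : ∀ {x y z} → 0# ≤ z → x ≤ y → z * x ≤ z * y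
  *-monoʳ-≤ {x} {y} {z} 0≤z x≤y =
    ≤-respˡ-≈ (*-comm x z) (≤-respʳ-≈ (*-comm y z) (*-monoˡ-≤ 0≤z x≤y))

  *-cancelʳ : ∀ {x y z} → ¬ z ≈ 0# → x * z ≈ y * z → x ≈ y
  *-cancelʳ {x} {y} {z} z≉0 xz≈yz with z⁻¹ , zz⁻¹≈1 ← inverse z z≉0 = begin-equality
    x              ≈⟨ *-identityʳ x ⟨
    x * 1#         ≈⟨ *-congˡ zz⁻¹≈1 ⟨
    x * (z * z⁻¹)  ≈⟨ *-assoc x z z⁻¹ ⟨
    x * z * z⁻¹    ≈⟨ *-congʳ xz≈yz ⟩
    y * z * z⁻¹    ≈⟨ *-assoc y z z⁻¹ ⟩
    y * (z * z⁻¹)  ≈⟨ *-congˡ zz⁻¹≈1 ⟩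
    y * 1#         ≈⟨ *-identityʳ y ⟩
    y              ∎

  0≤1 : 0# ≤ 1#
  0≤1 with total 0# 1#
  ... | inj₁ 0≤1 = 0≤1
  ... | inj₂ 1≤0 = begin
    0#           ≤⟨ *-nonNeg 0≤-1 0≤-1 ⟩
    - 1# * - 1#  ≈⟨ -1*x≈-x (- 1#) ⟩
    - - 1#       ≈⟨ ⁻¹-involutive 1# ⟩
    1#           ∎
    where
    0≤-1 : 0# ≤ - 1#
    0≤-1 = ≤-respʳ-≈ (+-identityˡ (- 1#)) (x≤y⇒0≤y-x 1≤0)

  0<1 : 0# < 1#
  0<1 = 0≤1 , 0≉1

  1≤x⇒0<x : ∀ {x} → 1# ≤ x → 0# < x
  1≤x⇒0<x 1≤x = ≤-trans 0≤1 1≤x ,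
    λ 0≈x → 0≉1 (antisym 0≤1 (≤-respʳ-≈ (Eq.sym 0≈x) 1≤x))

  <⇒≉0 : ∀ {x} → 0# < x → ¬ x ≈ 0#
  <⇒≉0 (_ , 0≉x) x≈0 = 0≉x (Eq.sym x≈0)

  *-pos : ∀ {x y} → 0# < x → 0# < y → 0# < x * y
  *-pos {x} {y} (0≤x , 0≉x) 0<y@(0≤y , _) = *-nonNeg 0≤x 0≤y ,
    λ 0≈xy → 0≉x (*-cancelʳ (<⇒≉0 0<y) (Eq.trans (zeroˡ y) 0≈xy))

  ^-pos : ∀ {x} n → 0# < x → 0# < x ^ n
  ^-pos zero    0<x = 0<1
  ^-pos (suc n) 0<x = *-pos 0<x (^-pos n 0<x)

  1≤x⇒x≤x^[1+n] : ∀ {x} n → 1# ≤ x → x ≤ x ^ suc n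
  1≤x⇒1≤x^n     : ∀ {x} n → 1# ≤ x → 1# ≤ x ^ n

  1≤x⇒x≤x^[1+n] {x} n 1≤x = begin
    x          ≈⟨ *-identityʳ x ⟨
    x * 1#     ≤⟨ *-monoʳ-≤ (proj₁ (1≤x⇒0<x 1≤x)) (1≤x⇒1≤x^n n 1≤x) ⟩
    x * x ^ n  ∎

  1≤x⇒1≤x^n zero    1≤x = refl
  1≤x⇒1≤x^n (suc n) 1≤x = ≤-trans 1≤x (1≤x⇒x≤x^[1+n] n 1≤x)

  ^-nonNeg : ∀ {x} n → 0# ≤ x → 0# ≤ x ^ n
  ^-nonNeg zero    0≤x = 0≤1
  ^-nonNeg (suc n) 0≤x = *-nonNeg 0≤x (^-nonNeg n 0≤x)

  ^-monoˡ-≤ : ∀ {x y} n → 0# ≤ x → x ≤ y → x ^ n ≤ y ^ n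
  ^-monoˡ-≤         zero    0≤x x≤y = refl
  ^-monoˡ-≤ {x} {y} (suc n) 0≤x x≤y = begin
    x * x ^ n  ≤⟨ *-monoˡ-≤ (^-nonNeg n 0≤x) x≤y ⟩
    y * x ^ n  ≤⟨ *-monoʳ-≤ (≤-trans 0≤x x≤y) (^-monoˡ-≤ n 0≤x x≤y) ⟩
    y * y ^ n  ∎

  -- With exponent `suc n` and `x ≤ y`, monotonicity gives `x * x ^ n ≤ y * x ^ n ≤ y * y ^ n`. The
  -- ends agree, so the first two terms do, and the positive factor `x ^ n` cancels.
  ^-injectiveˡ : ∀ {x y} n .{{_ : ℕ.NonZero n}} → 0# < x → 0# < y → x ^ n ≈ y ^ n → x ≈ y
  ^-injectiveˡ {x} {y} (suc n) 0<x 0<y xⁿ≈yⁿ = [ go 0<x xⁿ≈yⁿ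
    , (λ y≤x → Eq.sym (go 0<y (Eq.sym xⁿ≈yⁿ) y≤x)) ]′ (total x y)
    where
    go : ∀ {x y} → 0# < x → x ^ suc n ≈ y ^ suc n → x ≤ y → x ≈ y
    go {x} {y} 0<x xⁿ≈yⁿ x≤y = *-cancelʳ (<⇒≉0 (^-pos n 0<x)) (antisym
      (*-monoˡ-≤ (proj₁ (^-pos n 0<x)) x≤y)
      (begin
        y * x ^ n  ≤⟨ *-monoʳ-≤ (≤-trans (proj₁ 0<x) x≤y) (^-monoˡ-≤ n (proj₁ 0<x) x≤y) ⟩
        y * y ^ n  ≈⟨ xⁿ≈yⁿ ⟨
        x * x ^ n  ∎))

  -- Iterated powers, roots, and multiples of `N`-th powers.

  ^-^-* : ∀ x m n → (x ^ m) ^ n ≈ x ^ (n ℕ.* m)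
  ^-^-* x m n = Eq.trans (^-assocʳ x m n) (^-congʳ x (ℕₚ.*-comm m n))

  ^-^-+ : ∀ x n m k → (x ^ (n ℕ.^ m)) ^ (n ℕ.^ k) ≈ x ^ (n ℕ.^ (k ℕ.+ m))
  ^-^-+ x n m k = Eq.trans (^-^-* x (n ℕ.^ m) (n ℕ.^ k))
                           (^-congʳ x (≡.sym (ℕₚ.^-distribˡ-+-* n k m)))

  root-of-quotient : ∀ {u v x} n → 0# < u → u ^ n * x ≈ v ^ n → ∃[ y ] y ^ n ≈ x
  root-of-quotient {u} {v} {x} n 0<u uⁿx≈vⁿ with u⁻¹ , uu⁻¹≈1 ← inverse u (<⇒≉0 0<u) =
    v * u⁻¹ , *-cancelʳ (<⇒≉0 (^-pos n 0<u)) (begin-equality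
      (v * u⁻¹) ^ n * u ^ n  ≈⟨ ^-distrib-* (v * u⁻¹) u n ⟨
      (v * u⁻¹ * u) ^ n      ≈⟨ ^-congˡ n (*-assoc v u⁻¹ u) ⟩
      (v * (u⁻¹ * u)) ^ n    ≈⟨ ^-congˡ n (*-congˡ (Eq.trans (*-comm u⁻¹ u) uu⁻¹≈1)) ⟩
      (v * 1#) ^ n           ≈⟨ ^-congˡ n (*-identityʳ v) ⟩
      v ^ n                  ≈⟨ uⁿx≈vⁿ ⟨
      u ^ n * x              ≈⟨ *-comm (u ^ n) x ⟩
      x * u ^ n              ∎)

  -- The common n ^ i-th power cancels from both sides, leaving x as a quotient
  -- of n-th powers.
  root-of-coincidence : ∀ {x z z′} n .{{_ : ℕ.NonZero n}} {i j m} → i ℕ.< j → i ℕ.< m →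
    0# < x → 0# < z → 0# < z′ →
    z ^ (n ℕ.^ m) * x ^ (n ℕ.^ i) ≈ z′ ^ (n ℕ.^ m) * x ^ (n ℕ.^ j) →
    ∃[ y ] y ^ n ≈ x
  root-of-coincidence {x} {z} {z′} n {i} i<j i<m 0<x 0<z 0<z′ eq
    -- Now `j` is `i + suc d` and `m` is `i + suc e`. After cancelling, the exponents `n ^ suc e`
    -- and `n ^ suc d` are still multiples of `n`; for the first this is where `i < m` enters.
    with d , ≡.refl ← <⇒∃-suc i<j | e , ≡.refl ← <⇒∃-suc i<m =
    root-of-quotient {z ^ (n ℕ.^ e)} {z′ ^ (n ℕ.^ e) * x ^ (n ℕ.^ d)} n (^-pos (n ℕ.^ e) 0<z)
    (begin-equality
      (z ^ (n ℕ.^ e)) ^ n * x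
        ≈⟨ *-congʳ (^-^-* z (n ℕ.^ e) n) ⟩
      z ^ q * x
        ≈⟨ ^-injectiveˡ (n ℕ.^ i) {{ℕₚ.m^n≢0 n i}} (*-pos (^-pos q 0<z) 0<x)
             (*-pos (^-pos q 0<z′) (^-pos (n ℕ.^ suc d) 0<x)) powers-agree ⟩
      z′ ^ q * x ^ (n ℕ.^ suc d)
        ≈⟨ *-cong (^-^-* z′ (n ℕ.^ e) n) (^-^-* x (n ℕ.^ d) n) ⟨
      (z′ ^ (n ℕ.^ e)) ^ n * (x ^ (n ℕ.^ d)) ^ n
        ≈⟨ ^-distrib-* (z′ ^ (n ℕ.^ e)) (x ^ (n ℕ.^ d)) n ⟨
      (z′ ^ (n ℕ.^ e) * x ^ (n ℕ.^ d)) ^ n ∎)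
    where
    q = n ℕ.^ suc e

    powers-agree : (z ^ q * x) ^ (n ℕ.^ i) ≈ (z′ ^ q * x ^ (n ℕ.^ suc d)) ^ (n ℕ.^ i)
    powers-agree = begin-equality
      (z ^ q * x) ^ (n ℕ.^ i)
        ≈⟨ ^-distrib-* (z ^ q) x (n ℕ.^ i) ⟩
      (z ^ q) ^ (n ℕ.^ i) * x ^ (n ℕ.^ i)
        ≈⟨ *-congʳ (^-^-+ z n (suc e) i) ⟩
      z ^ (n ℕ.^ (i ℕ.+ suc e)) * x ^ (n ℕ.^ i)
        ≈⟨ eq ⟩
      z′ ^ (n ℕ.^ (i ℕ.+ suc e)) * x ^ (n ℕ.^ (i ℕ.+ suc d))
        ≈⟨ *-cong (^-^-+ z′ n (suc e) i) (^-^-+ x n (suc d) i) ⟨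
      (z′ ^ q) ^ (n ℕ.^ i) * (x ^ (n ℕ.^ suc d)) ^ (n ℕ.^ i)
        ≈⟨ ^-distrib-* (z′ ^ q) (x ^ (n ℕ.^ suc d)) (n ℕ.^ i) ⟨
      (z′ ^ q * x ^ (n ℕ.^ suc d)) ^ (n ℕ.^ i) ∎

  -- Restricting to 1 ≤ z keeps 0 out of the set, and it costs nothing: a
  -- common element still makes g / g′ an N-th power.
  PowerMultiple : ℕ → Carrier → Pred Carrier (c ⊔ ℓ)
  PowerMultiple N g w = ∃[ z ] Lift c (1# ≤ z) × Lift c (w ≈ z ^ N * g)

  -- A common element equates two multiples, and the smaller index marks the side on which `x` is
  -- left bare after cancelling.
  power-multiples-disjoint : ∀ {x} n .{{_ : ℕ.NonZero n}} m → 0# < x →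
    ¬ (∃[ y ] y ^ n ≈ x) →
    Disjoint {I = Fin m} (λ i → PowerMultiple (n ℕ.^ m) (x ^ (n ℕ.^ toℕ i)))
  power-multiples-disjoint n m 0<x rootless {i} {j} i≢j
    (z , lift 1≤z , lift w≈) (z′ , lift 1≤z′ , lift w≈′) with Finₚ.<-cmp i j
  ... | tri≈ _ i≡j _ = i≢j i≡j
  ... | tri< i<j _ _ = rootless (root-of-coincidence n i<j (toℕ<n i) 0<x
                         (1≤x⇒0<x 1≤z) (1≤x⇒0<x 1≤z′) (Eq.trans (Eq.sym w≈) w≈′))
  ... | tri> _ _ j<i = rootless (root-of-coincidence n j<i (toℕ<n j) 0<x
                         (1≤x⇒0<x 1≤z′) (1≤x⇒0<x 1≤z) (Eq.trans (Eq.sym w≈′) w≈))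

  power-multiple-unbounded : ∀ {g} N .{{_ : ℕ.NonZero N}} → 0# < g →
    Unbounded _≤_ (PowerMultiple N g)
  power-multiple-unbounded {g} N@(suc N-1) 0<g@(0≤g , _) b with h , gh≈1 ← inverse g (<⇒≉0 0<g) =
    z ^ N * g , (z , lift 1≤z , lift Eq.refl) , λ zᴺg≤b → 0≉1 (antisym 0≤1 (begin
      1#                      ≈⟨ //-rightDividesʳ b 1# ⟨
      1# + b - b              ≈⟨ +-congʳ (*-identityʳ (1# + b)) ⟨
      (1# + b) * 1# - b       ≈⟨ +-congʳ (*-congˡ (Eq.trans (*-comm h g) gh≈1)) ⟨
      (1# + b) * (h * g) - b  ≈⟨ +-congʳ (*-assoc (1# + b) h g) ⟨
      (1# + b) * h * g - b    ≤⟨ +-monoˡ-≤ (- b) (*-monoˡ-≤ 0≤g bh≤z) ⟩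
      z * g - b               ≤⟨ +-monoˡ-≤ (- b) (*-monoˡ-≤ 0≤g (1≤x⇒x≤x^[1+n] N-1 1≤z)) ⟩
      z ^ N * g - b           ≤⟨ +-monoˡ-≤ (- b) zᴺg≤b ⟩
      b - b                   ≈⟨ -‿inverseʳ b ⟩
      0#                      ∎))
    where
    -- Since `h` inverts `g`, the listed entry forces `z * g` up to at least `1# + b`; the default
    -- `1#` gives `z ≤ z ^ N`, as `N` is a successor.
    z = max 1# List.[ (1# + b) * h ]
    1≤z : 1# ≤ z
    1≤z = ⊥≤max 1# List.[ (1# + b) * h ]
    bh≤z : (1# + b) * h ≤ z
    bh≤z = head (xs≤max 1# List.[ (1# + b) * h ])

-- First-order formulas for rays and power multiples.

module Definability (𝔽 : OrderedField c ℓ) where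
  open OrderedField 𝔽 using (Carrier; _≈_; _*_; _^_; *-identityˡ; *-assoc; *-congˡ; 1#)
    renaming (sym to ≈-sym; trans to ≈-trans)
  open OrderedFieldProperties 𝔽 using (PowerMultiple)
  open Semantics (structure 𝔽)

  private
    FieldTerm FieldFormula : ℕ → Set
    FieldTerm    = Term orderedFieldSignature
    FieldFormula = Formula orderedFieldSignature

  -- Its definable set unfolds to `Lift c (w ≤ b)`, the form in which rays are consumed.
  rayFormula : FieldFormula 2
  rayFormula = rel leq (var zero ∷ var (suc zero) ∷ [])

  -- Starting from `t` instead of an empty product covers exponent zero without a term for 1.
  monomial : ∀ {n} → FieldTerm n → ℕ → FieldTerm n → FieldTerm n
  monomial s zero    t = t
  monomial s (suc N) t = app times (s ∷ monomial s N t ∷ [])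

  eval-monomial : ∀ {n} (ρ : Fin n → Carrier) s N t →
    eval ρ (monomial s N t) ≈ eval ρ s ^ N * eval ρ t
  eval-monomial ρ s zero    t = ≈-sym (*-identityˡ (eval ρ t))
  eval-monomial ρ s (suc N) t =
    ≈-trans (*-congˡ (eval-monomial ρ s N t)) (≈-sym (*-assoc _ _ _))

  -- 1 is passed as a parameter because the signature has no constants.
  powerMultipleFormula : ℕ → FieldFormula 3
  powerMultipleFormula N =
    ∃ᶠ (rel leq (var (suc (suc (suc zero))) ∷ var zero ∷ []) ∧ᶠ
        (var (suc zero) ≐ᶠ monomial (var zero) N (var (suc (suc zero)))))

  powerMultiple-definable : ∀ N g →
    definableSet (powerMultipleFormula N) (g ∷ 1# ∷ []) ≐ PowerMultiple N g
  powerMultiple-definable N g =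
    (λ (z , 1≤z , lift w≈) → z , 1≤z , lift (≈-trans w≈ (eval-monomial _ (var zero) N _))) ,
    (λ (z , 1≤z , lift w≈) → z , 1≤z , lift (≈-trans w≈ (≈-sym (eval-monomial _ (var zero) N _))))

proposition3p6 : ∀ {c ℓ : Level} → ExcludedMiddle (c ⊔ ℓ) →
    (𝔽 : OrderedField c ℓ) → ConvexlyOrderable (structure 𝔽) →
    let open OrderedField 𝔽 in
    (n : ℕ) → 1 ℕ.≤ n → (x : Carrier) → 0# < x → ∃ λ (y : Carrier) → y ^ n ≈ x
proposition3p6 em 𝔽 co n@(suc _) 1≤n x 0<x = em⇒dne em λ rootless →
  let k , rays = bounded rayFormula
      -- The order of choices avoids circularity: `k` comes from rays alone and fixes `m`, hence the
      -- exponent `n ^ m`; only then does the formula with that exponent receive its bound `l`,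
      -- uniform in the parameter `g`.
      m = suc (k ℕ.* 2)
      l , multiples = bounded (powerMultipleFormula (n ℕ.^ m))
  in few-unbounded 0# (IsTotalOrder.total isTotalOrder)
       (λ b → rays (b ∷ []))
       (power-multiples-disjoint n m 0<x rootless)
       (λ i → l , UnionOfAtMost-resp-≐ (powerMultiple-definable (n ℕ.^ m) _) (multiples _))
       (λ i → power-multiple-unbounded (n ℕ.^ m) {{ℕₚ.m^n≢0 n m}} (^-pos (n ℕ.^ toℕ i) 0<x))
  where
  open OrderedField 𝔽 using (0#)
  open OrderedFieldProperties 𝔽
  open Definability 𝔽
  open Unboundedness em ≤-totalOrder
  open ConvexlyOrderable co
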